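{- Let $n,x$ be integers with $1<x<n$, so that $G=C_{2n}(x,1,n)$ is a $5$-regular circulant graph. If $n\equiv 0 \pmod 3$, $x\equiv 1\pmod 3$ and $x<\tfrac{n}{2}$, then $G$ is word-representable.
   Context: Two distinct letters $x,y$ alternate in a word $w$ if, after deleting all other letters from $w$, the resulting word is of the form $xyxy\cdots$ or $yxyx\cdots$ (of even or odd length). A graph $G=(V,E)$ is word-representable if there is a word $w$ over the alphabet $V$, containing every letter of $V$ at least once, such that for all distinct $x,y\in V$, $xy\in E$ if and only if $x$ and $y$ alternate in $w$. For an integer $m$ and a set $R$ of positive integers each at most $m/2$, the circulant graph $C_m(R)$ has vertex set $\{0,1,\dots,m-1\}$, with $i$ and $j$ adjacent iff $\min(|i-j|,\,m-|i-j|)\in R$. $C_{2n}(x,1,n)$ denotes the circulant graph on $2n$ vertices with jump set $\{1,x,n\}$; it is $5$-regular exactly when $1<x<n$. -}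

module Defs where

open import Data.Fin.Base using (Fin; toℕ)
open import Data.Fin.Properties using (_≟_)
open import Data.List.Base using (List; []; _∷_; filter)
open import Data.List.Membership.Propositional using (_∈_)
open import Data.List.Relation.Unary.All using (All; []; _∷_; lookup)
open import Data.Nat.Base using (ℕ; zero; suc; _*_; _∸_; _⊓_; ∣_-_∣; _≤_; _<_; z≤n; s≤s)
open import Data.Nat.Properties
  using (∣-∣-comm; ∣n-n∣≡0; ≤-refl; <⇒≤; <-trans; *-monoʳ-≤; n≮0)
open import Data.Product.Base using (_×_; _,_; proj₁; ∃-syntax)
open import Data.Sum.Base using (_⊎_)
open import Function.Bundles using (_⇔_)
open import Relation.Binary.Core using (Rel)
open import Relation.Binary.Definitions using (DecidableEquality; Symmetric)
open import Relation.Binary.PropositionalEquality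
  using (_≡_; _≢_; subst)
open import Relation.Nullary using (¬_)
open import Relation.Nullary.Decidable using (_⊎-dec_)
open import Level using (0ℓ)

record SimpleGraph : Set₁ where
  field
    V       : Set
    _≟ⱽ_    : DecidableEquality V
    Adj     : Rel V 0ℓ
    symm    : Symmetric Adj
    irrefl  : ∀ v → ¬ Adj v v

-- alternating x y k is the word x y x y ⋯ of length k.
alternating : {A : Set} → A → A → ℕ → List A
alternating x y zero    = []
alternating x y (suc k) = x ∷ alternating y x k

module _ {A : Set} (_≟ᴬ_ : DecidableEquality A) where

  restrict : A → A → List A → List A
  restrict x y = filter (λ z → (z ≟ᴬ x) ⊎-dec (z ≟ᴬ y))

  Alternate : A → A → List A → Set
  Alternate x y w =
    ∃[ k ] (restrict x y w ≡ alternating x y k ⊎ restrict x y w ≡ alternating y x k)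

WordRepresentable : SimpleGraph → Set
WordRepresentable G =
  ∃[ w ] ((∀ v → v ∈ w) × (∀ x y → x ≢ y → Adj x y ⇔ Alternate _≟ⱽ_ x y w))
  where open SimpleGraph G

IsJump : ℕ → ℕ → Set
IsJump m r = 0 < r × 2 * r ≤ m

circularDistance : (m : ℕ) → Fin m → Fin m → ℕ
circularDistance m i j = ∣ toℕ i - toℕ j ∣ ⊓ (m ∸ ∣ toℕ i - toℕ j ∣)

circulant : (m : ℕ) (R : List ℕ) → All (IsJump m) R → SimpleGraph
circulant m R jumps = record
  { V      = Fin m
  ; _≟ⱽ_   = _≟_
  ; Adj    = λ i j → circularDistance m i j ∈ R
  ; symm   = λ {i} {j} →
      subst (λ d → d ⊓ (m ∸ d) ∈ R) (∣-∣-comm (toℕ i) (toℕ j))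
  ; irrefl = λ i i∼i →
      n≮0 (proj₁ (lookup jumps
        (subst (λ d → d ⊓ (m ∸ d) ∈ R) (∣n-n∣≡0 (toℕ i)) i∼i)))
  }

C₂ₙ[_,1,_] : (x n : ℕ) → 1 < x → x < n → SimpleGraph
C₂ₙ[ x ,1, n ] 1<x x<n = circulant (2 * n) (1 ∷ x ∷ n ∷ [])
  ( (s≤s z≤n , *-monoʳ-≤ 2 (<⇒≤ 1<n))
  ∷ (0<x     , *-monoʳ-≤ 2 (<⇒≤ x<n))
  ∷ (<-trans 0<x x<n , ≤-refl)
  ∷ [])
  where
  0<x : 0 < x
  0<x = <-trans (s≤s z≤n) 1<x
  1<n : 1 < n
  1<n = <-trans 1<x x<n

{-# OPTIONS --safe #-}

-- Colour i < 2n by i + s(i) mod 3, where s is 0 on [0, n), 1 on [n, n + x) and 2 on [n + x, 2n).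
-- Going round the circle, s makes three unit steps (the last from 2 to 3 ≡ 0), spaced at least x
-- apart because 2x < n. So a jump of 1 or x, which is ≡ 1 mod 3, changes the colour by 1 or 2,
-- and a jump of n ≡ 0 changes it by s(i + n) − s(i), again 1 or 2: the colouring is proper.
--
-- A 3-coloured graph is represented by a concatenation of one block per vertex v. Every block
-- restricts on each edge xy with x of smaller colour to xy⋯xy, so edges alternate throughout, while
-- the block of v contains a repetition against each non-neighbour of v of colour at most that of v.
module Submission where

open import Defs
open import Data.Bool.Base using (Bool; true; false; if_then_else_)
open import Data.Bool.Properties using () renaming (_≟_ to _≟ᵇ_)
open import Data.Fin.Base as Fin using (Fin; toℕ)
open import Data.Fin.Patterns using (0F; 1F; 2F)
open import Data.Fin.Properties as Fin using (all?; toℕ<n; fromℕ<-injective)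
open import Data.List.Base using (List; []; _∷_; [_]; _++_; map; filter; concatMap)
open import Data.List.Membership.Propositional using (_∈_; lose)
open import Data.List.Membership.Propositional.Properties
  using (∈-filter⁺; ∈-filter⁻; ∈-concatMap⁺; ∈-∃++; ∈-allFin)
open import Data.List.Properties as List
  using (filter-++; filter-accept; filter-reject; filter-none; map-++; concatMap-++)
open import Data.List.Relation.Unary.All as All using ()
open import Data.List.Relation.Unary.AllPairs using (_∷_)
open import Data.List.Relation.Unary.Any using (here; there)
open import Data.List.Relation.Unary.Linked as Linked using (Linked; []; [-]; _∷_; linked?)
import Data.List.Relation.Unary.Linked.Properties as Linked
open import Data.List.Relation.Unary.Unique.Propositional using (Unique)
import Data.List.Relation.Unary.Unique.Propositional.Properties as Unique
open import Data.Maybe.Base using (Maybe; just; nothing)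
import Data.Maybe.Properties as Maybe
open import Data.Nat.Base
  using (ℕ; zero; suc; _+_; _*_; _∸_; _⊓_; _/_; _%_; _≤_; _<_; NonZero)
open import Data.Nat.DivMod using (_mod_; m≡m%n+[m/n]*n; m%n<n; %-distribˡ-+)
open import Data.Nat.Divisibility
  using (_∣_; _∣?_; _∣0; ∣-refl; ∣m∣n⇒∣m+n; ∣m+n∣m⇒∣n; n∣m*n; ∣n⇒∣m*n; m%n≡0⇒n∣m; n∣m⇒m%n≡0)
open import Data.Nat.Properties
  using ( _≟_; _<?_; ≤-refl; ≤-trans; <-trans; <-≤-trans; <⇒≤; <⇒≱; m≤m+n; m≤n+m; m∸n≤m
        ; m+n≤o⇒m≤o; +-assoc; +-comm; +-identityʳ; +-monoʳ-≤; +-monoˡ-<; +-mono-<-≤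
        ; +-cancelˡ-≡; +-cancelʳ-≡; +-cancelʳ-≤; +-cancelʳ-<; m+[n∸m]≡n; m≤n⇒∣m-n∣≡n∸m; ⊓-sel
        ; module ≤-Reasoning)
open import Data.List.Membership.DecPropositional _≟_ using (_∈?_)
open import Data.Nat.Solver using (module +-*-Solver)
open import Data.Product.Base using (_×_; _,_; proj₂; ∃-syntax)
import Data.Product.Properties as Product
open import Data.Sum.Base using (_⊎_; inj₁; inj₂; swap; [_,_]′)
open import Function.Base using (_∘_)
open import Function.Bundles using (mk⇔)
open import Level using (0ℓ)
open import Relation.Binary.Definitions using (DecidableEquality; tri<; tri≈; tri>)
open import Relation.Binary.PropositionalEquality
  using (_≡_; _≢_; refl; sym; trans; cong; cong₂; subst; module ≡-Reasoning)
open import Relation.Nullary using (¬_; Dec; yes; no; contradiction)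
open import Relation.Nullary.Decidable
  using (does; dec-true; dec-false; from-yes; from-no; ¬?; _→-dec_)
open import Relation.Unary using (Pred; Decidable)

-- Alternating words, lists without adjacent repetitions, filters with one survivor.

alternating-++ : ∀ {A : Set} (x y : A) k l →
  alternating x y (k * 2) ++ alternating x y (l * 2) ≡ alternating x y ((k + l) * 2)
alternating-++ x y zero    l = refl
alternating-++ x y (suc k) l = cong (λ w → x ∷ y ∷ w) (alternating-++ x y k l)

map-alternating : ∀ {A B : Set} (f : A → B) x y k →
  map f (alternating x y k) ≡ alternating (f x) (f y) k
map-alternating f x y zero    = refl
map-alternating f x y (suc k) = cong (f x ∷_) (map-alternating f y x k)

alternating-linked : ∀ {A : Set} {x y : A} → x ≢ y → ∀ k → Linked _≢_ (alternating x y k)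
alternating-linked x≢y zero          = []
alternating-linked x≢y (suc zero)    = [-]
alternating-linked x≢y (suc (suc k)) = x≢y ∷ alternating-linked (x≢y ∘ sym) (suc k)

linked-++ˡ : ∀ {A : Set} {R : A → A → Set} xs {ys} → Linked R (xs ++ ys) → Linked R xs
linked-++ˡ []           _         = []
linked-++ˡ (x ∷ [])     _         = [-]
linked-++ˡ (x ∷ y ∷ xs) (r ∷ rs)  = r ∷ linked-++ˡ (y ∷ xs) rs

linked-++ʳ : ∀ {A : Set} {R : A → A → Set} xs {ys} → Linked R (xs ++ ys) → Linked R ys
linked-++ʳ []       rs = rs
linked-++ʳ (x ∷ xs) rs = linked-++ʳ xs (Linked.tail rs)

filter-singleton : ∀ {A : Set} {P : Pred A 0ℓ} (P? : Decidable P) {x xs} →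
  Unique xs → x ∈ xs → P x → (∀ {y} → y ∈ xs → P y → y ≡ x) → filter P? xs ≡ [ x ]
filter-singleton P? (x∉xs ∷ _) (here refl) px only =
  trans (filter-accept P? px) (cong (_ ∷_) (filter-none P? (All.tabulate λ y∈xs py →
    All.lookup x∉xs y∈xs (sym (only (there y∈xs) py)))))
filter-singleton P? (h∉xs ∷ uniq) (there x∈xs) px only =
  trans (filter-reject P? λ ph → All.lookup h∉xs x∈xs (only (here refl) ph))
        (filter-singleton P? uniq x∈xs px (only ∘ there))

-- Restriction of words to two letters.

module _ {A : Set} (_≟ᴬ_ : DecidableEquality A) where

  restrict-++ : ∀ x y v w →
    restrict _≟ᴬ_ x y (v ++ w) ≡ restrict _≟ᴬ_ x y v ++ restrict _≟ᴬ_ x y w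
  restrict-++ x y = filter-++ _

  restrict-comm : ∀ x y w → restrict _≟ᴬ_ x y w ≡ restrict _≟ᴬ_ y x w
  restrict-comm x y []      = refl
  restrict-comm x y (z ∷ w) with ih ← restrict-comm x y w | does (z ≟ᴬ x) | does (z ≟ᴬ y)
  ... | true  | true  = cong (z ∷_) ih
  ... | true  | false = cong (z ∷_) ih
  ... | false | true  = cong (z ∷_) ih
  ... | false | false = ih

  alternate-sym : ∀ {x y} w → Alternate _≟ᴬ_ x y w → Alternate _≟ᴬ_ y x w
  alternate-sym {x} {y} w (k , alt) =
    k , subst (λ v → v ≡ alternating y x k ⊎ v ≡ alternating x y k) (restrict-comm x y w) (swap alt)

  -- Used to refute alternation: one repetition in any factor of the restriction violates
  -- `Linked _≢_`.
  alternate⇒linked : ∀ {x y} w → x ≢ y → Alternate _≟ᴬ_ x y w → Linked _≢_ (restrict _≟ᴬ_ x y w)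
  alternate⇒linked w x≢y (k , inj₁ eq) = subst (Linked _≢_) (sym eq) (alternating-linked x≢y k)
  alternate⇒linked w x≢y (k , inj₂ eq) =
    subst (Linked _≢_) (sym eq) (alternating-linked (x≢y ∘ sym) k)

-- Blowing up words over `R` to words over `A` along `ρ`.

module _ {A R : Set} (_≟ᴬ_ : DecidableEquality A) (_≟ʳ_ : DecidableEquality R)
         {xs : List A} (unique : Unique xs) (complete : ∀ x → x ∈ xs) (ρ : A → R) where

  fibre : R → List A
  fibre r = filter (λ x → ρ x ≟ʳ r) xs

  unique-fibre : ∀ {r} → Unique (fibre r)
  unique-fibre = Unique.filter⁺ _ unique

  ∈-fibre⁺ : ∀ x → x ∈ fibre (ρ x)
  ∈-fibre⁺ x = ∈-filter⁺ _ (complete x) refl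

  ∈-fibre⁻ : ∀ {r x} → x ∈ fibre r → ρ x ≡ r
  ∈-fibre⁻ {r} x∈ = proj₂ (∈-filter⁻ (λ x → ρ x ≟ʳ r) {xs = xs} x∈)

  -- Substituting fibres for letters reduces words over an arbitrary vertex set to fixed words over
  -- `R`, whose properties can be checked by evaluation.
  blowUp : List R → List A
  blowUp = concatMap fibre

  ∈-blowUp : ∀ {x rs} → ρ x ∈ rs → x ∈ blowUp rs
  ∈-blowUp {x} ρx∈rs = ∈-concatMap⁺ fibre (lose ρx∈rs (∈-fibre⁺ x))

  module _ {x y : A} (ρx≢ρy : ρ x ≢ ρ y) where

    -- A left inverse of `ρ` on `x` and `y`. The default `y` serves `ρ y`; other letters do not
    -- survive the restriction to `ρ x` and `ρ y`.
    choose : R → A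
    choose r = if does (r ≟ʳ ρ x) then x else y

    choose-x : choose (ρ x) ≡ x
    choose-x rewrite dec-true (ρ x ≟ʳ ρ x) refl = refl

    choose-y : choose (ρ y) ≡ y
    choose-y rewrite dec-false (ρ y ≟ʳ ρ x) (ρx≢ρy ∘ sym) = refl

    -- Since `ρ x` and `ρ y` differ, a fibre holds at most one of `x` and `y`, and holds it once
    -- because `xs` has no duplicates.
    restrict-fibre : ∀ r →
      restrict _≟ᴬ_ x y (fibre r) ≡ map choose (restrict _≟ʳ_ (ρ x) (ρ y) [ r ])
    restrict-fibre r with r ≟ʳ ρ x | r ≟ʳ ρ y
    ... | yes refl | _        =
      trans (filter-singleton _ unique-fibre (∈-fibre⁺ x) (inj₁ refl)
               λ { z∈ (inj₁ z≡x) → z≡x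
                 ; z∈ (inj₂ refl) → contradiction (sym (∈-fibre⁻ z∈)) ρx≢ρy })
            (cong [_] (sym choose-x))
    ... | no _     | yes refl =
      trans (filter-singleton _ unique-fibre (∈-fibre⁺ y) (inj₂ refl)
               λ { z∈ (inj₁ refl) → contradiction (∈-fibre⁻ z∈) ρx≢ρy
                 ; z∈ (inj₂ z≡y) → z≡y })
            (cong [_] (sym choose-y))
    ... | no r≢ρx  | no r≢ρy  = filter-none _ {xs = fibre r} (All.tabulate
            λ { z∈ (inj₁ refl) → r≢ρx (sym (∈-fibre⁻ z∈))
              ; z∈ (inj₂ refl) → r≢ρy (sym (∈-fibre⁻ z∈)) })

    restrict-blowUp : ∀ rs →
      restrict _≟ᴬ_ x y (blowUp rs) ≡ map choose (restrict _≟ʳ_ (ρ x) (ρ y) rs)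
    restrict-blowUp []       = refl
    restrict-blowUp (r ∷ rs) = begin
      restrict _≟ᴬ_ x y (fibre r ++ blowUp rs)
        ≡⟨ restrict-++ _≟ᴬ_ x y (fibre r) (blowUp rs) ⟩
      restrict _≟ᴬ_ x y (fibre r) ++ restrict _≟ᴬ_ x y (blowUp rs)
        ≡⟨ cong₂ _++_ (restrict-fibre r) (restrict-blowUp rs) ⟩
      map choose (restrict _≟ʳ_ (ρ x) (ρ y) [ r ]) ++ map choose (restrict _≟ʳ_ (ρ x) (ρ y) rs)
        ≡⟨ map-++ choose (restrict _≟ʳ_ (ρ x) (ρ y) [ r ]) _ ⟨
      map choose (restrict _≟ʳ_ (ρ x) (ρ y) [ r ] ++ restrict _≟ʳ_ (ρ x) (ρ y) rs)
        ≡⟨ cong (map choose) (restrict-++ _≟ʳ_ (ρ x) (ρ y) [ r ] rs) ⟨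
      map choose (restrict _≟ʳ_ (ρ x) (ρ y) (r ∷ rs)) ∎
      where open ≡-Reasoning

    restrict-blowUp-alternating : ∀ rs {k} →
      restrict _≟ʳ_ (ρ x) (ρ y) rs ≡ alternating (ρ x) (ρ y) k →
      restrict _≟ᴬ_ x y (blowUp rs) ≡ alternating x y k
    restrict-blowUp-alternating rs {k} eq = begin
      restrict _≟ᴬ_ x y (blowUp rs)                   ≡⟨ restrict-blowUp rs ⟩
      map choose (restrict _≟ʳ_ (ρ x) (ρ y) rs)      ≡⟨ cong (map choose) eq ⟩
      map choose (alternating (ρ x) (ρ y) k)         ≡⟨ map-alternating choose (ρ x) (ρ y) k ⟩
      alternating (choose (ρ x)) (choose (ρ y)) k
        ≡⟨ cong₂ (λ a b → alternating a b k) choose-x choose-y ⟩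
      alternating x y k                              ∎
      where open ≡-Reasoning

    -- Letters with distinct images under the function `choose` are themselves distinct.
    linked-blowUp⁻ : ∀ rs → Linked _≢_ (restrict _≟ᴬ_ x y (blowUp rs)) →
      Linked _≢_ (restrict _≟ʳ_ (ρ x) (ρ y) rs)
    linked-blowUp⁻ rs linked =
      Linked.map (_∘ cong choose) (Linked.map⁻ (subst (Linked _≢_) (restrict-blowUp rs) linked))

-- Blocks as words over roles.

Colour : Set
Colour = Fin 3

-- The role of a vertex relative to a fixed vertex: that vertex itself, or a neighbour (near) or
-- non-neighbour (far) of the given colour.
Role : Set
Role = Maybe (Bool × Colour)

pattern self   = nothing
pattern near c = just (true , c)
pattern far c  = just (false , c)

_≟ʳ_ : DecidableEquality Role
_≟ʳ_ = Maybe.≡-dec (Product.≡-dec _≟ᵇ_ Fin._≟_)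

class : Colour → List Role
class c = near c ∷ far c ∷ []

-- Blocks 0F and 1F consist of two linear extensions of the orientation towards larger colours.
-- In block 2F the vertices of role far 0F may be joined to self by a path through colour 1, so no
-- linear extensions separate them; instead they come twice before the second self.
block : Colour → List Role
block 0F = self ∷ class 0F ++ class 1F ++ class 2F ++
           class 0F ++ self ∷ class 1F ++ class 2F
block 1F = near 0F ∷ self ∷ far 0F ∷ class 1F ++ class 2F ++
           class 0F ++ class 1F ++ self ∷ class 2F
block 2F = class 0F ++ near 1F ∷ self ∷ far 1F ∷ class 2F ++
           class 0F ++ class 1F ++ class 2F ++
           far 0F ∷ self ∷ near 0F ∷ class 1F ++ self ∷ class 2F

-- Each role occurs this often in the block.
periods : Colour → ℕ
periods 0F = 2
periods 1F = 2
periods 2F = 3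

self∈block : ∀ k → self ∈ block k
self∈block 0F = here refl
self∈block 1F = there (here refl)
self∈block 2F = there (there (there (here refl)))

-- The role pairs that an edge, read towards the larger colour, can show to a vertex of colour `k`.
-- If that vertex is one end, the other end is near; otherwise the adjacency flags are arbitrary.
data Directed (k : Colour) : Role → Role → Set where
  out   : ∀ {c} → k Fin.< c → Directed k self (near c)
  into  : ∀ {c} → c Fin.< k → Directed k (near c) self
  avoid : ∀ {b b′ c c′} → c Fin.< c′ → Directed k (just (b , c)) (just (b′ , c′))

directed⇒≢ : ∀ {k r s} → Directed k r s → r ≢ s
directed⇒≢ (avoid c<c′) refl = Fin.<⇒≢ c<c′ refl

BlockAlternates : Colour → Role → Role → Set
BlockAlternates k r s = restrict _≟ʳ_ r s (block k) ≡ alternating r s (periods k * 2)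

blockAlternates? : ∀ k r s → Dec (BlockAlternates k r s)
blockAlternates? k r s = List.≡-dec _≟ʳ_ _ _

-- There are finitely many cases, decided by evaluating the blocks. The Booleans are split by hand,
-- since `all?` enumerates `Fin`.
block-alternates : ∀ {k r s} → Directed k r s → BlockAlternates k r s
block-alternates (out k<c)  =
  from-yes (all? λ k → all? λ c → (k Fin.<? c) →-dec blockAlternates? k self (near c)) _ _ k<c
block-alternates (into c<k) =
  from-yes (all? λ k → all? λ c → (c Fin.<? k) →-dec blockAlternates? k (near c) self) _ _ c<k
block-alternates {k} (avoid {b} {b′} c<c′) = avoiding b b′ k _ _ c<c′
  where
  Avoiding : Bool → Bool → Set
  Avoiding b b′ = ∀ k c c′ → c Fin.< c′ → BlockAlternates k (just (b , c)) (just (b′ , c′))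
  avoiding? : ∀ b b′ → Dec (Avoiding b b′)
  avoiding? b b′ = all? λ k → all? λ c → all? λ c′ → (c Fin.<? c′) →-dec blockAlternates? k _ _
  avoiding : ∀ b b′ → Avoiding b b′
  avoiding true  true  = from-yes (avoiding? true true)
  avoiding true  false = from-yes (avoiding? true false)
  avoiding false true  = from-yes (avoiding? false true)
  avoiding false false = from-yes (avoiding? false false)

-- Again by evaluation. The bound `c ≤ k` is enough: of two non-adjacent vertices, one whose colour
-- is at least the other's supplies the repetition.
block-breaks : ∀ {k c} → c Fin.≤ k → ¬ Linked _≢_ (restrict _≟ʳ_ self (far c) (block k))
block-breaks {k} {c} = from-yes
  (all? λ k → all? λ c → (c Fin.≤? k) →-dec
    ¬? (linked? (λ r s → ¬? (r ≟ʳ s)) (restrict _≟ʳ_ self (far c) (block k)))) k c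

-- Word-representability of 3-coloured graphs.

module _ (G : SimpleGraph) (adj? : ∀ u v → Dec (SimpleGraph.Adj G u v))
         {vs : List (SimpleGraph.V G)} (unique : Unique vs) (complete : ∀ v → v ∈ vs)
         (colour : SimpleGraph.V G → Colour)
         (proper : ∀ {u v} → SimpleGraph.Adj G u v → colour u ≢ colour v) where

  open SimpleGraph G

  role : V → V → Role
  role v u with v ≟ⱽ u
  ... | yes _ = self
  ... | no  _ = just (does (adj? v u) , colour u)

  role-self : ∀ v → role v v ≡ self
  role-self v with v ≟ⱽ v
  ... | yes _   = refl
  ... | no  v≢v = contradiction refl v≢v

  role-far : ∀ {v u} → v ≢ u → ¬ Adj v u → role v u ≡ far (colour u)
  role-far {v} {u} v≢u v≁u with v ≟ⱽ u
  ... | yes v≡u = contradiction v≡u v≢u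
  ... | no  _   rewrite dec-false (adj? v u) v≁u = refl

  -- The end colours differ, so at most one end is `v`, and then the other end is near it.
  edge-directed : ∀ {x y} v → Adj x y → colour x Fin.< colour y →
    Directed (colour v) (role v x) (role v y)
  edge-directed {x} {y} v x∼y cx<cy with v ≟ⱽ x | v ≟ⱽ y
  ... | yes refl | yes refl = contradiction refl (Fin.<⇒≢ cx<cy)
  ... | yes refl | no _     rewrite dec-true (adj? x y) x∼y = out cx<cy
  ... | no _     | yes refl rewrite dec-true (adj? y x) (symm x∼y) = into cx<cy
  ... | no _     | no _     = avoid cx<cy

  vertexBlock : V → List V
  vertexBlock v = blowUp _≟ⱽ_ _≟ʳ_ unique complete (role v) (block (colour v))

  word : List V
  word = concatMap vertexBlock vs

  ∈-word : ∀ v → v ∈ word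
  ∈-word v = ∈-concatMap⁺ vertexBlock (lose (complete v)
    (∈-blowUp _≟ⱽ_ _≟ʳ_ unique complete (role v)
      (subst (_∈ block (colour v)) (sym (role-self v)) (self∈block (colour v)))))

  -- Every block contributes whole periods beginning with the end of smaller colour, so no
  -- repetition arises where two blocks meet.
  blocks-alternate : ∀ {x y} → Adj x y → colour x Fin.< colour y → ∀ us →
    ∃[ k ] restrict _≟ⱽ_ x y (concatMap vertexBlock us) ≡ alternating x y (k * 2)
  blocks-alternate x∼y cx<cy [] = 0 , refl
  blocks-alternate {x} {y} x∼y cx<cy (u ∷ us)
    with d ← edge-directed u x∼y cx<cy
       | k , eq ← blocks-alternate x∼y cx<cy us
    = periods (colour u) + k , (begin
      restrict _≟ⱽ_ x y (vertexBlock u ++ concatMap vertexBlock us)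
        ≡⟨ restrict-++ _≟ⱽ_ x y (vertexBlock u) _ ⟩
      restrict _≟ⱽ_ x y (vertexBlock u) ++ restrict _≟ⱽ_ x y (concatMap vertexBlock us)
        ≡⟨ cong₂ _++_ (restrict-blowUp-alternating _≟ⱽ_ _≟ʳ_ unique complete (role u)
                         (directed⇒≢ d) (block (colour u)) (block-alternates d)) eq ⟩
      alternating x y (periods (colour u) * 2) ++ alternating x y (k * 2)
        ≡⟨ alternating-++ x y (periods (colour u)) k ⟩
      alternating x y ((periods (colour u) + k) * 2) ∎)
    where open ≡-Reasoning

  edge⇒alternate : ∀ {x y} → Adj x y → Alternate _≟ⱽ_ x y word
  edge⇒alternate {x} {y} x∼y with Fin.<-cmp (colour x) (colour y)
  ... | tri< cx<cy _ _ with k , eq ← blocks-alternate x∼y cx<cy vs = k * 2 , inj₁ eq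
  ... | tri≈ _ cx≡cy _ = contradiction cx≡cy (proper x∼y)
  ... | tri> _ _ cy<cx with k , eq ← blocks-alternate (symm x∼y) cy<cx vs =
    alternate-sym _≟ⱽ_ word (k * 2 , inj₁ eq)

  -- The block of `x` is a factor of the word, and in it `y` has a far role of colour at most that
  -- of `x`; its repetition survives in the whole word.
  nonEdge-breaks : ∀ {x y} → x ≢ y → ¬ Adj x y → colour y Fin.≤ colour x →
    ¬ Alternate _≟ⱽ_ x y word
  nonEdge-breaks {x} {y} x≢y x≁y cy≤cx alt
    with pre , post , refl ← ∈-∃++ (complete x) = block-breaks cy≤cx
      (subst (Linked _≢_)
        (cong₂ (λ r s → restrict _≟ʳ_ r s (block (colour x))) (role-self x) (role-far x≢y x≁y))
        (linked-blowUp⁻ _≟ⱽ_ _≟ʳ_ unique complete (role x) roles≢ (block (colour x)) block-linked))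
    where
    roles≢ : role x x ≢ role x y
    roles≢ eq with () ← trans (sym (role-self x)) (trans eq (role-far x≢y x≁y))
    word-linked : Linked _≢_ (restrict _≟ⱽ_ x y
      (concatMap vertexBlock pre ++ vertexBlock x ++ concatMap vertexBlock post))
    word-linked = subst (Linked _≢_ ∘ restrict _≟ⱽ_ x y) (concatMap-++ vertexBlock pre (x ∷ post))
      (alternate⇒linked _≟ⱽ_ word x≢y alt)
    block-linked : Linked _≢_ (restrict _≟ⱽ_ x y (vertexBlock x))
    block-linked = linked-++ˡ _ (subst (Linked _≢_) (restrict-++ _≟ⱽ_ x y (vertexBlock x) _)
      (linked-++ʳ _ (subst (Linked _≢_) (restrict-++ _≟ⱽ_ x y (concatMap vertexBlock pre) _)
        word-linked)))

  alternate⇒edge : ∀ {x y} → x ≢ y → Alternate _≟ⱽ_ x y word → Adj x y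
  alternate⇒edge {x} {y} x≢y alt with adj? x y
  ... | yes x∼y = x∼y
  ... | no x≁y  with Fin.≤-total (colour y) (colour x)
  ...   | inj₁ cy≤cx = contradiction alt (nonEdge-breaks x≢y x≁y cy≤cx)
  ...   | inj₂ cx≤cy =
    contradiction (alternate-sym _≟ⱽ_ word alt) (nonEdge-breaks (x≢y ∘ sym) (x≁y ∘ symm) cx≤cy)

  3-colourable⇒wordRepresentable : WordRepresentable G
  3-colourable⇒wordRepresentable =
    word , ∈-word , λ x y x≢y → mk⇔ edge⇒alternate (alternate⇒edge x≢y)

-- Residues and circular distance.

-- The equal remainders cancel, so `d` and `e` differ by a multiple of `m`. Sums on both sides avoid
-- truncated subtraction.
%-cancel-∣ : ∀ {a b d e} m .{{_ : NonZero m}} →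
  a % m ≡ b % m → a + d ≡ b + e → m ∣ d → m ∣ e
%-cancel-∣ {a} {b} {d} {e} m a%m≡b%m a+d≡b+e m∣d =
  ∣m+n∣m⇒∣n (subst (m ∣_) quotients (∣m∣n⇒∣m+n (n∣m*n (a / m)) m∣d)) (n∣m*n (b / m))
  where
  open ≡-Reasoning
  quotients : a / m * m + d ≡ b / m * m + e
  quotients = +-cancelˡ-≡ (a % m) _ _ (begin
    a % m + (a / m * m + d)  ≡⟨ +-assoc (a % m) _ d ⟨
    a % m + a / m * m + d    ≡⟨ cong (_+ d) (m≡m%n+[m/n]*n a m) ⟨
    a + d                    ≡⟨ a+d≡b+e ⟩
    b + e                    ≡⟨ cong (_+ e) (m≡m%n+[m/n]*n b m) ⟩
    b % m + b / m * m + e    ≡⟨ +-assoc (b % m) _ e ⟩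
    b % m + (b / m * m + e)  ≡⟨ cong (_+ (b / m * m + e)) a%m≡b%m ⟨
    a % m + (b / m * m + e)  ∎)

%≡1⇒∤ : ∀ {t} → t % 3 ≡ 1 → ¬ 3 ∣ t
%≡1⇒∤ {t} t%3≡1 3∣t with () ← trans (sym t%3≡1) (n∣m⇒m%n≡0 t 3 3∣t)

%≡1⇒∤suc : ∀ {t} → t % 3 ≡ 1 → ¬ 3 ∣ suc t
%≡1⇒∤suc {t} t%3≡1 3∣1+t
  with () ← trans (sym (trans (%-distribˡ-+ 1 t 3) (cong (λ r → (1 + r) % 3) t%3≡1)))
                  (n∣m⇒m%n≡0 (suc t) 3 3∣1+t)

-- The minimum is attained on the arc from `i` up to `j` or on the arc from `j` through 0 to `i`.
circularDistance-< : ∀ {m t} (i j : Fin m) → i Fin.< j → circularDistance m i j ≡ t →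
  toℕ j ≡ toℕ i + t ⊎ toℕ j + t ≡ toℕ i + m
circularDistance-< {m} {t} i j i<j dist≡t = cases (⊓-sel d (m ∸ d))
  where
  open ≡-Reasoning
  d : ℕ
  d = toℕ j ∸ toℕ i
  i+d≡j : toℕ i + d ≡ toℕ j
  i+d≡j = m+[n∸m]≡n (<⇒≤ i<j)
  d≤m : d ≤ m
  d≤m = ≤-trans (m∸n≤m (toℕ j) (toℕ i)) (<⇒≤ (toℕ<n j))
  t≡d⊓ : t ≡ d ⊓ (m ∸ d)
  t≡d⊓ = trans (sym dist≡t) (cong (λ e → e ⊓ (m ∸ e)) (m≤n⇒∣m-n∣≡n∸m (<⇒≤ i<j)))
  cases : d ⊓ (m ∸ d) ≡ d ⊎ d ⊓ (m ∸ d) ≡ m ∸ d → toℕ j ≡ toℕ i + t ⊎ toℕ j + t ≡ toℕ i + m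
  cases (inj₁ short) = inj₁ (trans (sym i+d≡j) (cong (toℕ i +_) (sym (trans t≡d⊓ short))))
  cases (inj₂ wrap)  = inj₂ (begin
    toℕ j + t              ≡⟨ cong₂ _+_ (sym i+d≡j) (trans t≡d⊓ wrap) ⟩
    toℕ i + d + (m ∸ d)    ≡⟨ +-assoc (toℕ i) d _ ⟩
    toℕ i + (d + (m ∸ d))  ≡⟨ cong (toℕ i +_) (m+[n∸m]≡n d≤m) ⟩
    toℕ i + m              ∎)

-- The proper 3-colouring of the circulant graph.

module Colouring {n x : ℕ} (3∣n : 3 ∣ n) (x%3≡1 : x % 3 ≡ 1) (1<x : 1 < x) (2x<n : 2 * x < n) where

  level : ℕ → ℕ
  level i with i <? n | i <? n + x
  ... | yes _ | _     = 0
  ... | no _  | yes _ = 1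
  ... | no _  | no _  = 2

  level-low : ∀ {i} → i < n → level i ≡ 0
  level-low {i} i<n with i <? n
  ... | yes _  = refl
  ... | no i≮n = contradiction i<n i≮n

  level-high : ∀ {i} → n + x ≤ i → level i ≡ 2
  level-high {i} n+x≤i with i <? n | i <? n + x
  ... | yes i<n | _         = contradiction (≤-trans (m≤m+n n x) n+x≤i) (<⇒≱ i<n)
  ... | no _    | yes i<n+x = contradiction n+x≤i (<⇒≱ i<n+x)
  ... | no _    | no _      = refl

  level-upper : ∀ {i} → n ≤ i → level i ≡ 1 ⊎ level i ≡ 2
  level-upper {i} n≤i with i <? n | i <? n + x
  ... | yes i<n | _     = contradiction n≤i (<⇒≱ i<n)
  ... | no _    | yes _ = inj₁ refl
  ... | no _    | no _  = inj₂ refl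

  -- A jump of at most `x` cannot pass both thresholds `n` and `n + x`. The step at `2 * n` is left
  -- to `shifted-wrap`.
  level-step : ∀ i {t} → t ≤ x → level (i + t) ≡ level i ⊎ level (i + t) ≡ suc (level i)
  level-step i {t} t≤x with i <? n | i <? n + x | i + t <? n | i + t <? n + x
  ... | yes _   | _         | yes _     | _           = inj₁ refl
  ... | yes _   | _         | no _      | yes _       = inj₂ refl
  ... | yes i<n | _         | no _      | no i+t≮n+x  = contradiction (+-mono-<-≤ i<n t≤x) i+t≮n+x
  ... | no i≮n  | _         | yes i+t<n | _           = contradiction (m+n≤o⇒m≤o (suc i) i+t<n) i≮n
  ... | no _    | yes _     | no _      | yes _       = inj₁ refl
  ... | no _    | yes _     | no _      | no _        = inj₂ refl
  ... | no _    | no i≮n+x  | no _      | yes i+t<n+x =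
    contradiction (m+n≤o⇒m≤o (suc i) i+t<n+x) i≮n+x
  ... | no _    | no _      | no _      | no _        = inj₁ refl

  shifted : ℕ → ℕ
  shifted i = i + level i

  -- The change is `t` or `suc t`, which is 1 or 2 modulo 3.
  shifted-jump : ∀ i {t} → t ≤ x → t % 3 ≡ 1 → shifted i % 3 ≢ shifted (i + t) % 3
  shifted-jump i {t} t≤x t%3≡1 eq with level-step i t≤x
  ... | inj₁ same = %≡1⇒∤ t%3≡1 (%-cancel-∣ {shifted (i + t)} {shifted i} 3 (sym eq)
        (trans (cong (λ l → i + t + l + 0) same)
          (solve 3 (λ i t l → i :+ t :+ l :+ con 0 := i :+ l :+ t) refl i t (level i))) (3 ∣0))
    where open +-*-Solver
  ... | inj₂ next = %≡1⇒∤suc t%3≡1 (%-cancel-∣ {shifted (i + t)} {shifted i} 3 (sym eq)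
        (trans (cong (λ l → i + t + l + 0) next)
          (solve 3 (λ i t l → i :+ t :+ (con 1 :+ l) :+ con 0 := i :+ l :+ (con 1 :+ t))
            refl i t (level i))) (3 ∣0))
    where open +-*-Solver

  -- The jump leads from `j` through 0 to `i`, hence from level 2 to level 0.
  shifted-wrap : ∀ {i j t} → j < 2 * n → j + t ≡ i + 2 * n → t ≤ x → t % 3 ≡ 1 →
    shifted i % 3 ≢ shifted j % 3
  shifted-wrap {i} {j} {t} j<2n j+t≡i+2n t≤x t%3≡1 eq =
    %≡1⇒∤suc t%3≡1 (%-cancel-∣ {shifted i} {shifted j} 3 eq sums
      (∣m∣n⇒∣m+n (∣n⇒∣m*n 2 3∣n) ∣-refl))
    where
    x≤2x : x ≤ 2 * x
    x≤2x = m≤m+n x (x + 0)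
    i<t : i < t
    i<t = +-cancelʳ-< (2 * n) i t (subst (_< t + 2 * n) j+t≡i+2n
      (subst (j + t <_) (+-comm (2 * n) t) (+-monoˡ-< t j<2n)))
    i<n : i < n
    i<n = <-trans (<-≤-trans i<t (≤-trans t≤x x≤2x)) 2x<n
    -- `j` is at least `2 * n` minus `x`, which `2 * x < n` puts above the threshold `n + x`.
    n+x≤j : n + x ≤ j
    n+x≤j = +-cancelʳ-≤ t (n + x) j (begin
      n + x + t    ≤⟨ +-monoʳ-≤ (n + x) t≤x ⟩
      n + x + x    ≡⟨ solve 2 (λ n x → n :+ x :+ x := n :+ con 2 :* x) refl n x ⟩
      n + 2 * x    ≤⟨ +-monoʳ-≤ n (<⇒≤ 2x<n) ⟩
      n + n        ≡⟨ solve 1 (λ n → n :+ n := con 2 :* n) refl n ⟩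
      2 * n        ≤⟨ m≤n+m (2 * n) i ⟩
      i + 2 * n    ≡⟨ j+t≡i+2n ⟨
      j + t        ∎)
      where
      open ≤-Reasoning
      open +-*-Solver
    -- The 3 rereads level 0 at `i` as level 3, one step above level 2 at `j`; the total change is
    -- thus `suc t`.
    sums : shifted i + (2 * n + 3) ≡ shifted j + suc t
    sums = begin
      i + level i + (2 * n + 3)  ≡⟨ cong (λ l → i + l + (2 * n + 3)) (level-low i<n) ⟩
      i + 0 + (2 * n + 3)
        ≡⟨ solve 2 (λ i m → i :+ con 0 :+ (m :+ con 3) := i :+ m :+ con 3) refl i (2 * n) ⟩
      i + 2 * n + 3              ≡⟨ cong (_+ 3) j+t≡i+2n ⟨
      j + t + 3
        ≡⟨ solve 2 (λ j t → j :+ t :+ con 3 := j :+ con 2 :+ (con 1 :+ t)) refl j t ⟩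
      j + 2 + suc t              ≡⟨ cong (λ l → j + l + suc t) (level-high n+x≤j) ⟨
      j + level j + suc t        ∎
      where
      open ≡-Reasoning
      open +-*-Solver

  -- The lower end has level 0 and the upper one level 1 or 2. As 3 divides `n`, that level is the
  -- whole change modulo 3.
  shifted-antipode : ∀ {i} → i + n < 2 * n → shifted i % 3 ≢ shifted (i + n) % 3
  shifted-antipode {i} i+n<2n eq = [ (λ l≡1 → from-no (3 ∣? 1) (subst (3 ∣_) l≡1 3∣level))
                                   , (λ l≡2 → from-no (3 ∣? 2) (subst (3 ∣_) l≡2 3∣level))
                                   ]′ (level-upper (m≤n+m n i))
    where
    open +-*-Solver
    i<n : i < n
    i<n = +-cancelʳ-< n i n (subst (i + n <_) (cong (n +_) (+-identityʳ n)) i+n<2n)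
    sums : shifted (i + n) + 0 ≡ shifted i + (n + level (i + n))
    sums = trans
      (solve 3 (λ i n l → i :+ n :+ l :+ con 0 := i :+ con 0 :+ (n :+ l)) refl i n (level (i + n)))
      (cong (λ l → i + l + (n + level (i + n))) (sym (level-low i<n)))
    3∣level : 3 ∣ level (i + n)
    3∣level = ∣m+n∣m⇒∣n (%-cancel-∣ {shifted (i + n)} {shifted i} 3 (sym eq) sums (3 ∣0)) 3∣n

  shifted-short : ∀ {t} (i j : Fin (2 * n)) → i Fin.< j → circularDistance (2 * n) i j ≡ t →
    t ≤ x → t % 3 ≡ 1 → shifted (toℕ i) % 3 ≢ shifted (toℕ j) % 3
  shifted-short i j i<j dist≡t t≤x t%3≡1 with circularDistance-< i j i<j dist≡t
  ... | inj₁ j≡i+t    rewrite j≡i+t = shifted-jump (toℕ i) t≤x t%3≡1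
  ... | inj₂ j+t≡i+2n = shifted-wrap {toℕ i} (toℕ<n j) j+t≡i+2n t≤x t%3≡1

  shifted-proper : ∀ i j → i Fin.< j → circularDistance (2 * n) i j ∈ 1 ∷ x ∷ n ∷ [] →
    shifted (toℕ i) % 3 ≢ shifted (toℕ j) % 3
  shifted-proper i j i<j (here dist≡1)         = shifted-short i j i<j dist≡1 (<⇒≤ 1<x) refl
  shifted-proper i j i<j (there (here dist≡x)) = shifted-short i j i<j dist≡x ≤-refl x%3≡1
  shifted-proper i j i<j (there (there (here dist≡n))) =
    subst (λ k → shifted (toℕ i) % 3 ≢ shifted k % 3) (sym j≡i+n)
      (shifted-antipode (subst (_< 2 * n) j≡i+n (toℕ<n j)))
    where
    open +-*-Solver
    j≡i+n : toℕ j ≡ toℕ i + n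
    -- Both arcs between antipodes have length `n`, so the wrapping case yields the same equation.
    j≡i+n with circularDistance-< i j i<j dist≡n
    ... | inj₁ eq = eq
    ... | inj₂ eq = +-cancelʳ-≡ n (toℕ j) (toℕ i + n) (trans eq
          (solve 2 (λ i n → i :+ con 2 :* n := i :+ n :+ n) refl (toℕ i) n))

theorem23 : (n x : ℕ) (1<x : 1 < x) (x<n : x < n) →
    n % 3 ≡ 0 → x % 3 ≡ 1 → 2 * x < n →
    WordRepresentable (C₂ₙ[ x ,1, n ] 1<x x<n)
theorem23 n x 1<x x<n n%3≡0 x%3≡1 2x<n =
  3-colourable⇒wordRepresentable G (λ i j → circularDistance (2 * n) i j ∈? 1 ∷ x ∷ n ∷ [])
    (Unique.allFin⁺ (2 * n)) ∈-allFin vertexColour (λ {i} {j} → proper i j)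
  where
  open Colouring {n} {x} (m%n≡0⇒n∣m n 3 n%3≡0) x%3≡1 1<x 2x<n

  G : SimpleGraph
  G = C₂ₙ[ x ,1, n ] 1<x x<n

  open SimpleGraph G using (Adj; symm; irrefl)

  vertexColour : Fin (2 * n) → Fin 3
  vertexColour i = shifted (toℕ i) mod 3

  -- `_mod_` is the remainder packed by `fromℕ<`, which is injective.
  vertexColour-% : ∀ i j → vertexColour i ≡ vertexColour j →
    shifted (toℕ i) % 3 ≡ shifted (toℕ j) % 3
  vertexColour-% i j =
    fromℕ<-injective _ _ (m%n<n (shifted (toℕ i)) 3) (m%n<n (shifted (toℕ j)) 3)

  proper : ∀ i j → Adj i j → vertexColour i ≢ vertexColour j
  proper i j i∼j eq with Fin.<-cmp i j
  ... | tri< i<j _ _  = shifted-proper i j i<j i∼j (vertexColour-% i j eq)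
  ... | tri≈ _ refl _ = irrefl i i∼j
  ... | tri> _ _ j<i  = shifted-proper j i j<i (symm {i} {j} i∼j) (vertexColour-% j i (sym eq))
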